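{- For all $n\ge1$, $$A_n=[(n-1)_T\,0]_T+1,\qquad B_n=[(n-1)_T\,01]_T+1,\qquad C_n=[(n-1)_T\,011]_T+1.$$
   Context: Tribonacci numbers: $T_{ -3}=T_{ -2}=0$, $T_{ -1}=1$, $T_n=T_{n-1}+T_{n-2}+T_{n-3}$ for $n\ge0$ (so $T_0=1,T_1=2,T_2=4,T_3=7$). For a finite binary string $E=e_1\cdots e_i$, $[E]_T=\sum_{1\le j\le i}e_jT_{i-j}$. For an integer $m\ge0$, $(m)_T$ is the canonical Tribonacci representation of $m$: the binary string obtained by the greedy algorithm (repeatedly subtracting the largest possible Tribonacci number), least significant digit on the right, equivalently the string $E$ with $[E]_T=m$ having no three consecutive $1$'s (unique up to leading zeros). Expressions such as $(m)_T\,01$ denote concatenation of binary strings. The Tribonacci word $\mathbf T=t_1t_2t_3\cdots$ (indexed from $1$) is the infinite fixed point, beginning with $a$, of the morphism $\tau: a\to ab,\ b\to ac,\ c\to a$. For $n\ge1$, $A_n$ (resp. $B_n$, $C_n$) is the index of the $n$th occurrence of the letter $a$ (resp. $b$, $c$) in $\mathbf T$. -}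

module Defs where

open import Data.Digit using (Bit; 0b; 1b)
open import Data.Empty using (⊥)
open import Data.Fin using (toℕ)
import Data.Fin.Properties as Fin
open import Data.List using (List; []; _∷_; [_]; _++_; length; filter; concatMap; dropWhile; applyUpTo)
open import Data.List.Properties using (++-assoc; ++-identityʳ; concatMap-++; ∷-injectiveˡ; ∷-injectiveʳ)
open import Data.Nat using (ℕ; zero; suc; _+_; _*_; _∸_; _≤_; _<_; _≤?_; z≤n; s≤s; s≤s⁻¹)
open import Data.Nat.Properties using (+-suc; +-identityʳ; m≤n⇒m≤1+n; <⇒≤; ≤-trans; ≤-total; m≤n⇒∃[o]m+o≡n)
open import Data.Product using (_×_; _,_; ∃-syntax)
open import Data.Sum using (inj₁; inj₂)
open import Relation.Binary.Definitions using (DecidableEquality)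
open import Relation.Binary.PropositionalEquality using (_≡_; refl; sym; trans; cong; cong₂; subst)
open import Relation.Nullary using (yes; no)

-- The sequence is shifted so that it can be indexed by ℕ:  tribFrom-3 k  is  T_{k-3}.
tribFrom-3 : ℕ → ℕ
tribFrom-3 0 = 0
tribFrom-3 1 = 0
tribFrom-3 2 = 1
tribFrom-3 (suc (suc (suc k))) =
  tribFrom-3 (suc (suc k)) + tribFrom-3 (suc k) + tribFrom-3 k

T : ℕ → ℕ
T n = tribFrom-3 (3 + n)

-- Binary strings are lists with the most significant digit first, so the digit
-- e in  e ∷ E  carries the weight T_{|E|}.
[_]T : List Bit → ℕ
[ [] ]T    = 0
[ e ∷ E ]T = toℕ e * T (length E) + [ E ]T

-- The greedy digits of m in the positions of weights T_{k-1}, …, T_0.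
greedy : (k m : ℕ) → List Bit
greedy zero    m = []
greedy (suc k) m with T k ≤? m
... | yes _ = 1b ∷ greedy k (m ∸ T k)
... | no  _ = 0b ∷ greedy k m

-- Since T_m > m, no Tribonacci number with index ≥ m can be subtracted from m.
⟨_⟩T : ℕ → List Bit
⟨ m ⟩T = dropWhile (Fin._≟ 0b) (greedy m m)

data Letter : Set where
  a b c : Letter

infix 4 _≟_
_≟_ : DecidableEquality Letter
a ≟ a = yes refl
a ≟ b = no λ ()
a ≟ c = no λ ()
b ≟ a = no λ ()
b ≟ b = yes refl
b ≟ c = no λ ()
c ≟ a = no λ ()
c ≟ b = no λ ()
c ≟ c = yes refl

-- The letters of an infinite word w are  w 0, w 1, w 2, …
Word∞ : Set
Word∞ = ℕ → Letter

prefix : Word∞ → ℕ → List Letter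
prefix = applyUpTo

infix 4 _IsPrefixOf_
_IsPrefixOf_ : List Letter → Word∞ → Set
u IsPrefixOf w = prefix w (length u) ≡ u

-- The image of an infinite word under a morphism f that erases no letter is the
-- infinite word whose prefixes include the images of all the finite prefixes.
IsFixedPoint : (Letter → List Letter) → Word∞ → Set
IsFixedPoint f w = ∀ n → concatMap f (prefix w n) IsPrefixOf w

τ : Letter → List Letter
τ a = a ∷ b ∷ []
τ b = a ∷ c ∷ []
τ c = a ∷ []

IsTribonacciWord : Word∞ → Set
IsTribonacciWord t = t 0 ≡ a × IsFixedPoint τ t

-- "The n-th occurrence of x in w has index i", where indices start at 1: the
-- letter of index  suc j  is  w j.
IsNthOccurrence : Word∞ → Letter → ℕ → ℕ → Set
IsNthOccurrence w x n zero    = ⊥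
IsNthOccurrence w x n (suc j) =
  w j ≡ x × length (filter (x ≟_) (prefix w (suc j))) ≡ n

-- A Tribonacci word exists: its i-th letter can be read off τⁱ(a).

private
  τ* : List Letter → List Letter
  τ* = concatMap τ

  iter : ℕ → List Letter
  iter zero    = [ a ]
  iter (suc k) = τ* (iter k)

  letter : List Letter → ℕ → Letter
  letter []       _       = a
  letter (x ∷ xs) zero    = x
  letter (x ∷ xs) (suc i) = letter xs i

tribonacciWord : Word∞
tribonacciWord i = letter (iter i) i

private
  iter-suc : ∀ k → ∃[ v ] iter (suc k) ≡ iter k ++ v
  iter-suc zero = [ b ] , refl
  iter-suc (suc k) with iter-suc k
  ... | v , eq = τ* v , trans (cong τ* eq) (concatMap-++ τ (iter k) v)

  iter-+ : ∀ k j → ∃[ v ] iter (k + j) ≡ iter k ++ v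
  iter-+ k zero rewrite +-identityʳ k = [] , sym (++-identityʳ (iter k))
  iter-+ k (suc j) rewrite +-suc k j with iter-+ k j | iter-suc (k + j)
  ... | v , eq | v′ , eq′ = v ++ v′ , trans eq′ (trans (cong (_++ v′) eq) (++-assoc (iter k) v v′))

  length-τ* : ∀ u → length u ≤ length (τ* u)
  length-τ* []      = z≤n
  length-τ* (a ∷ u) = s≤s (m≤n⇒m≤1+n (length-τ* u))
  length-τ* (b ∷ u) = s≤s (m≤n⇒m≤1+n (length-τ* u))
  length-τ* (c ∷ u) = s≤s (length-τ* u)

  iter-a : ∀ k → ∃[ v ] iter k ≡ a ∷ v
  iter-a k = iter-+ 0 k

  length-iter : ∀ k → k < length (iter k)
  length-iter zero = s≤s z≤n
  length-iter (suc k) with iter k | iter-a k | length-iter k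
  ... | _ | v , refl | lt = s≤s (≤-trans lt (s≤s (length-τ* v)))

  letter-++ : ∀ u v i → i < length u → letter (u ++ v) i ≡ letter u i
  letter-++ (x ∷ u) v zero    _  = refl
  letter-++ (x ∷ u) v (suc i) lt = letter-++ u v i (s≤s⁻¹ lt)

  letter-iter : ∀ k i → i < length (iter k) → tribonacciWord i ≡ letter (iter k) i
  letter-iter k i lt with ≤-total i k
  ... | inj₁ i≤k with m≤n⇒∃[o]m+o≡n i≤k
  ...   | j , refl with iter-+ i j
  ...     | v , eq = sym (trans (cong (λ u → letter u i) eq) (letter-++ (iter i) v i (length-iter i)))
  letter-iter k i lt | inj₂ k≤i with m≤n⇒∃[o]m+o≡n k≤i
  ...   | j , refl with iter-+ k j
  ...     | v , eq = trans (cong (λ u → letter u i) eq) (letter-++ (iter k) v i lt)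

  isPrefix : ∀ u (w : Word∞) → (∀ i → i < length u → w i ≡ letter u i) → u IsPrefixOf w
  isPrefix []      w h = refl
  isPrefix (x ∷ u) w h = cong₂ _∷_ (h 0 (s≤s z≤n)) (isPrefix u (λ i → w (suc i)) λ i lt → h (suc i) (s≤s lt))

  isPrefix-++ : ∀ u v (w : Word∞) → (u ++ v) IsPrefixOf w → u IsPrefixOf w
  isPrefix-++ []      v w h = refl
  isPrefix-++ (x ∷ u) v w h = cong₂ _∷_ (∷-injectiveˡ h) (isPrefix-++ u v _ (∷-injectiveʳ h))

  prefix-≤ : ∀ {m n} (w : Word∞) → m ≤ n → ∃[ v ] prefix w n ≡ prefix w m ++ v
  prefix-≤ w z≤n       = _ , refl
  prefix-≤ w (s≤s m≤n) with prefix-≤ (λ i → w (suc i)) m≤n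
  ... | v , eq = v , cong (w 0 ∷_) eq

  iter-prefix : ∀ k → iter k IsPrefixOf tribonacciWord
  iter-prefix k = isPrefix (iter k) tribonacciWord (letter-iter k)

tribonacciWord-correct : IsTribonacciWord tribonacciWord
tribonacciWord-correct = refl , fixed
  where
  fixed : IsFixedPoint τ tribonacciWord
  fixed n with prefix-≤ tribonacciWord (<⇒≤ (length-iter n))
  ... | v , eq = isPrefix-++ (τ* p) (τ* v) tribonacciWord
                   (subst (_IsPrefixOf tribonacciWord) iter≡ (iter-prefix (suc n)))
    where
    p = prefix tribonacciWord n
    iter≡ : iter (suc n) ≡ τ* p ++ τ* v
    iter≡ = trans (cong τ* (trans (sym (iter-prefix n)) eq)) (concatMap-++ τ p v)

{-# OPTIONS --safe #-}
module Submission where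

-- Let  σ m  be the length of the image under τ of the first m letters of the
-- Tribonacci word t, so that this image is the prefix of t of length  σ m.
--
-- Occurrences.  With positions counted from 0, each block  τ (t m)  occupies
-- positions from  σ m  on.  It starts with a and contains no other a, it has a
-- b (at position  σ m + 1)  exactly when  t m  is a, and a c (at the same
-- position) exactly when  t m  is b.  So the occurrences of a, b, c that are
-- preceded by exactly k occurrences of the same letter are at the positions
-- σ k,  σ (σ k) + 1  and  σ (σ (σ k) + 1) + 1  (occurs-a, occurs-b, occurs-c).
--
-- Numeration.  Reading a binary string from its most significant digit, let
-- each digit e send the position m to  σ m + e  (positionFrom).  When the string
-- never has three consecutive 1's, the position reached from 0 is its value
-- [ E ]T  (value≡position): the digit 1 steps over a letter a, which the k
-- digits still to come expand into the word  τᵏ(a)  of length  T k.  Appending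
-- a digit to a string therefore acts on values as  m ↦ σ m + e,  and the three
-- positions above are the values of  ⟨ k ⟩T  followed by 0, 01 and 011.
--
-- Greedy digits.  A number below |τᵏ(x)| is represented by its k greedy digits,
-- and they are admissible after as many 1's as the letter x records
-- (greedy-admissible, greedy-value), because  |τᵏ⁺¹(x)|  is  T k  plus the
-- length of the image under τᵏ of the second letter of  τ x,  if there is one.

open import Defs
open import Data.Digit using (Bit; 0b; 1b)
open import Data.Fin using (zero; suc; toℕ)
import Data.Fin.Properties as Fin
open import Data.List using (List; []; _∷_; [_]; _++_; length; filter; concatMap; dropWhile; map)
open import Data.List.Properties
  using (++-assoc; ++-identityʳ; concatMap-++; length-++; filter-++; filter-accept; map-++;
         length-applyUpTo; applyUpTo-∷ʳ; ∷-injectiveˡ; ∷-injectiveʳ)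
open import Data.Nat using (ℕ; zero; suc; _+_; _*_; _∸_; _≤_; _<_; _≰_; _≤?_; z≤n; s≤s)
open import Data.Nat.ListAction using (sum)
open import Data.Nat.ListAction.Properties using (sum-++)
open import Data.Nat.Properties hiding (_≟_; _≤?_)
open import Data.Product using (_×_; _,_)
open import Function.Bundles using (_⇔_; mk⇔)
open import Relation.Binary.Definitions using (tri<; tri≈; tri>)
open import Relation.Binary.PropositionalEquality
  using (_≡_; refl; sym; trans; cong; cong₂; subst; subst₂; module ≡-Reasoning)
open import Relation.Nullary using (yes; no; contradiction)

-- Lengths of iterated images under τ

-- The length of τᵏ(x).
τ-length : ℕ → Letter → ℕ
τ-length zero    x = 1
τ-length (suc k) a = τ-length k a + τ-length k b
τ-length (suc k) b = τ-length k a + τ-length k c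
τ-length (suc k) c = τ-length k a

-- The length of τᵏ(u).
τ-length* : ℕ → List Letter → ℕ
τ-length* k u = sum (map (τ-length k) u)

τ-length*-++ : ∀ k u v → τ-length* k (u ++ v) ≡ τ-length* k u + τ-length* k v
τ-length*-++ k u v = trans (cong sum (map-++ (τ-length k) u v)) (sum-++ (map (τ-length k) u) _)

τ-length*-zero : ∀ u → τ-length* 0 u ≡ length u
τ-length*-zero []      = refl
τ-length*-zero (x ∷ u) = cong suc (τ-length*-zero u)

τ-length*-τ : ∀ k x → τ-length* k (τ x) ≡ τ-length (suc k) x
τ-length*-τ k a = cong (τ-length k a +_) (+-identityʳ _)
τ-length*-τ k b = cong (τ-length k a +_) (+-identityʳ _)
τ-length*-τ k c = +-identityʳ _

τ-length*-suc : ∀ k u → τ-length* (suc k) u ≡ τ-length* k (concatMap τ u)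
τ-length*-suc k []      = refl
τ-length*-suc k (x ∷ u) = sym (trans (τ-length*-++ k (τ x) (concatMap τ u))
  (cong₂ _+_ (τ-length*-τ k x) (sym (τ-length*-suc k u))))

τ-length-a : ∀ k → τ-length k a ≡ T k
τ-length-a 0 = refl
τ-length-a 1 = refl
τ-length-a 2 = refl
τ-length-a (suc (suc (suc k))) = trans
  (sym (+-assoc (τ-length (2 + k) a) (τ-length (1 + k) a) (τ-length k a)))
  (cong₂ _+_ (cong₂ _+_ (τ-length-a (suc (suc k))) (τ-length-a (suc k))) (τ-length-a k))

τ-length-positive : ∀ k x → 0 < τ-length k x
τ-length-positive zero    x = s≤s z≤n
τ-length-positive (suc k) a = ≤-trans (τ-length-positive k a) (m≤m+n _ _)
τ-length-positive (suc k) b = ≤-trans (τ-length-positive k a) (m≤m+n _ _)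
τ-length-positive (suc k) c = τ-length-positive k a

m<τ-length-a : ∀ m → m < τ-length m a
m<τ-length-a zero    = s≤s z≤n
m<τ-length-a (suc m) = subst (_< τ-length (suc m) a) (+-comm m 1)
  (+-mono-<-≤ (m<τ-length-a m) (τ-length-positive m b))

-- Admissible strings and greedy digits

-- Admissible x E  says that E has no three consecutive 1's, even when it is
-- preceded by as many 1's as x records: none for a, one for b, two for c.
-- A digit 1 leads from a to b and from b to c; a digit 0 leads back to a.
data Admissible : Letter → List Bit → Set where
  end   : ∀ {x} → Admissible x []
  zero  : ∀ {x E} → Admissible a E → Admissible x (0b ∷ E)
  one-a : ∀ {E} → Admissible b E → Admissible a (1b ∷ E)
  one-b : ∀ {E} → Admissible c E → Admissible b (1b ∷ E)

admissible-++0 : ∀ {x E F} → Admissible x E → Admissible a F → Admissible x (E ++ 0b ∷ F)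
admissible-++0 end       q = zero q
admissible-++0 (zero p)  q = zero (admissible-++0 p q)
admissible-++0 (one-a p) q = one-a (admissible-++0 p q)
admissible-++0 (one-b p) q = one-b (admissible-++0 p q)

length-greedy : ∀ k m → length (greedy k m) ≡ k
length-greedy zero    m = refl
length-greedy (suc k) m with T k ≤? m
... | yes _ = cong suc (length-greedy k (m ∸ T k))
... | no  _ = cong suc (length-greedy k m)

∸-<-τ-length : ∀ k {m} n → T k ≤ m → m < τ-length k a + n → m ∸ T k < n
∸-<-τ-length k n T≤m m< = +-cancelˡ-< (T k) _ _
  (subst₂ _<_ (sym (m+[n∸m]≡n T≤m)) (cong (_+ n) (τ-length-a k)) m<)

≰T⇒<τ-length : ∀ k {m} → T k ≰ m → m < τ-length k a
≰T⇒<τ-length k T≰m = subst (_ <_) (sym (τ-length-a k)) (≰⇒> T≰m)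

greedy-admissible : ∀ k x m → m < τ-length k x → Admissible x (greedy k m)
greedy-admissible zero    x m m< = end
greedy-admissible (suc k) x m m< with T k ≤? m
... | no  T≰m = zero (greedy-admissible k a m (≰T⇒<τ-length k T≰m))
greedy-admissible (suc k) a m m< | yes T≤m =
  one-a (greedy-admissible k b _ (∸-<-τ-length k _ T≤m m<))
greedy-admissible (suc k) b m m< | yes T≤m =
  one-b (greedy-admissible k c _ (∸-<-τ-length k _ T≤m m<))
-- After two 1's no further 1 is possible, since  |τᵏ⁺¹(c)| = T k.
greedy-admissible (suc k) c m m< | yes T≤m =
  contradiction (subst (m <_) (τ-length-a k) m<) (≤⇒≯ T≤m)

greedy-value : ∀ k x m → m < τ-length k x → [ greedy k m ]T ≡ m
greedy-value zero    x m m< = sym (n<1⇒n≡0 m<)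
greedy-value (suc k) x m m< with T k ≤? m
... | no  T≰m = greedy-value k a m (≰T⇒<τ-length k T≰m)
greedy-value (suc k) x m m< | yes T≤m = trans
  (cong₂ _+_ (trans (*-identityˡ _) (cong T (length-greedy k (m ∸ T k)))) (rest x m<))
  (m+[n∸m]≡n T≤m)
  where
  rest : ∀ x → m < τ-length (suc k) x → [ greedy k (m ∸ T k) ]T ≡ m ∸ T k
  rest a m< = greedy-value k b _ (∸-<-τ-length k _ T≤m m<)
  rest b m< = greedy-value k c _ (∸-<-τ-length k _ T≤m m<)
  rest c m< = contradiction (subst (m <_) (τ-length-a k) m<) (≤⇒≯ T≤m)

dropZeros-admissible : ∀ {E} → Admissible a E → Admissible a (dropWhile (Fin._≟ 0b) E)
dropZeros-admissible end       = end
dropZeros-admissible (zero p)  = dropZeros-admissible p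
dropZeros-admissible (one-a p) = one-a p

dropZeros-value : ∀ E → [ dropWhile (Fin._≟ 0b) E ]T ≡ [ E ]T
dropZeros-value []             = refl
dropZeros-value (zero ∷ E)     = dropZeros-value E
dropZeros-value (suc zero ∷ E) = refl

⟨⟩-admissible : ∀ m → Admissible a ⟨ m ⟩T
⟨⟩-admissible m = dropZeros-admissible (greedy-admissible m a m (m<τ-length-a m))

⟨⟩-value : ∀ m → [ ⟨ m ⟩T ]T ≡ m
⟨⟩-value m = trans (dropZeros-value (greedy m m)) (greedy-value m a m (m<τ-length-a m))

-- Occurrences of letters

count : Letter → List Letter → ℕ
count x u = length (filter (x ≟_) u)

count-++ : ∀ x u v → count x (u ++ v) ≡ count x u + count x v
count-++ x u v = trans (cong length (filter-++ (x ≟_) u v)) (length-++ (filter (x ≟_) u))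

count-τ-a : ∀ u → count a (concatMap τ u) ≡ length u
count-τ-a []      = refl
count-τ-a (a ∷ u) = cong suc (count-τ-a u)
count-τ-a (b ∷ u) = cong suc (count-τ-a u)
count-τ-a (c ∷ u) = cong suc (count-τ-a u)

count-τ-b : ∀ u → count b (concatMap τ u) ≡ count a u
count-τ-b []      = refl
count-τ-b (a ∷ u) = cong suc (count-τ-b u)
count-τ-b (b ∷ u) = count-τ-b u
count-τ-b (c ∷ u) = count-τ-b u

count-τ-c : ∀ u → count c (concatMap τ u) ≡ count b u
count-τ-c []      = refl
count-τ-c (a ∷ u) = count-τ-c u
count-τ-c (b ∷ u) = cong suc (count-τ-c u)
count-τ-c (c ∷ u) = count-τ-c u

prefix-suc : ∀ (w : Word∞) m → prefix w (suc m) ≡ prefix w m ++ [ w m ]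
prefix-suc w m = sym (applyUpTo-∷ʳ w m)

letter-after : ∀ u {x v} (w : Word∞) → (u ++ x ∷ v) IsPrefixOf w → w (length u) ≡ x
letter-after []      w h = ∷-injectiveˡ h
letter-after (y ∷ u) w h = letter-after u (λ i → w (suc i)) (∷-injectiveʳ h)

-- With positions counted from 0: position j of w carries the letter x, and x
-- occurs exactly k times before it.
Occurs : Word∞ → Letter → ℕ → ℕ → Set
Occurs w x k j = w j ≡ x × count x (prefix w j) ≡ k

module _ (w : Word∞) (x : Letter) where

  count-prefix-mono : ∀ {i j} → i ≤ j → count x (prefix w i) ≤ count x (prefix w j)
  count-prefix-mono {i} {j} i≤j = subst (λ n → count x (prefix w i) ≤ count x (prefix w n))
    (m+[n∸m]≡n i≤j) (extend (j ∸ i))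
    where
    extend : ∀ d → count x (prefix w i) ≤ count x (prefix w (i + d))
    extend zero    = ≤-reflexive (cong (λ n → count x (prefix w n)) (sym (+-identityʳ i)))
    extend (suc d) = subst (λ n → count x (prefix w i) ≤ count x (prefix w n)) (sym (+-suc i d))
      (≤-trans (extend d) (≤-trans (m≤m+n _ _) (≤-reflexive (sym
        (trans (cong (count x) (prefix-suc w (i + d))) (count-++ x (prefix w (i + d)) _))))))

  count-prefix-suc : ∀ {j} → w j ≡ x → count x (prefix w (suc j)) ≡ suc (count x (prefix w j))
  count-prefix-suc {j} eq = trans (cong (count x) (prefix-suc w j))
    (trans (count-++ x (prefix w j) _)
      (trans (cong (count x (prefix w j) +_) (cong length (filter-accept (x ≟_) (sym eq))))
        (+-comm _ 1)))

  occurs-< : ∀ {k k′ i j} → i < j → Occurs w x k i → Occurs w x k′ j → k < k′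
  occurs-< i<j (eq , refl) (_ , refl) = subst (_≤ _) (count-prefix-suc eq) (count-prefix-mono i<j)

  occurs-unique : ∀ {k i j} → Occurs w x k i → Occurs w x k j → i ≡ j
  occurs-unique {i = i} {j} p q with <-cmp i j
  ... | tri≈ _ eq _ = eq
  ... | tri< lt _ _ = contradiction (occurs-< lt p q) (<-irrefl refl)
  ... | tri> _ _ gt = contradiction (occurs-< gt q p) (<-irrefl refl)

  occurs⇒isNthOccurrence⇔ : ∀ {k j} → Occurs w x k j → ∀ i → IsNthOccurrence w x (suc k) i ⇔ i ≡ j + 1
  occurs⇒isNthOccurrence⇔ {k} {j} occ@(eq , cnt) i = mk⇔ (to i) from
    where
    to : ∀ i → IsNthOccurrence w x (suc k) i → i ≡ j + 1
    to (suc i) (eq′ , cnt′) = trans (cong suc (occurs-unique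
        (eq′ , suc-injective (trans (sym (count-prefix-suc eq′)) cnt′)) occ))
      (+-comm 1 j)

    from : i ≡ j + 1 → IsNthOccurrence w x (suc k) i
    from refl rewrite +-comm j 1 = eq , trans (count-prefix-suc eq) (cong suc cnt)

module _ (t : Word∞) (fixed : IsFixedPoint τ t) where

  -- The block structure of a fixed point

  τ-prefix : ℕ → List Letter
  τ-prefix m = concatMap τ (prefix t m)

  -- The position at which the block  τ (t m)  starts.
  σ : ℕ → ℕ
  σ m = length (τ-prefix m)

  block : ∀ m → (τ-prefix m ++ τ (t m)) IsPrefixOf t
  block m = subst (_IsPrefixOf t) eq (fixed (suc m))
    where
    eq : τ-prefix (suc m) ≡ τ-prefix m ++ τ (t m)
    eq = trans (cong (concatMap τ) (prefix-suc t m))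
      (trans (concatMap-++ τ (prefix t m) _) (cong (τ-prefix m ++_) (++-identityʳ _)))

  block-a : ∀ m → t (σ m) ≡ a
  block-a m with t m | block m
  ... | a | h = letter-after (τ-prefix m) t h
  ... | b | h = letter-after (τ-prefix m) t h
  ... | c | h = letter-after (τ-prefix m) t h

  block-second : ∀ m {y z} → t m ≡ y → τ y ≡ a ∷ z ∷ [] → t (σ m + 1) ≡ z
  block-second m {z = z} refl τ≡ = subst (λ n → t n ≡ z) (length-++ (τ-prefix m))
    (letter-after (τ-prefix m ++ [ a ]) t
      (subst (_IsPrefixOf t)
        (trans (cong (τ-prefix m ++_) τ≡) (sym (++-assoc (τ-prefix m) [ a ] _))) (block m)))

  prefix-σ+1 : ∀ m → prefix t (σ m + 1) ≡ τ-prefix m ++ [ a ]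
  prefix-σ+1 m rewrite +-comm (σ m) 1 =
    trans (prefix-suc t (σ m)) (cong₂ (λ u x → u ++ [ x ]) (fixed m) (block-a m))

  count-σ+1 : ∀ y m → count y [ a ] ≡ 0 → count y (prefix t (σ m + 1)) ≡ count y (τ-prefix m)
  count-σ+1 y m no-y = trans (cong (count y) (prefix-σ+1 m))
    (trans (count-++ y (τ-prefix m) _) (trans (cong (count y (τ-prefix m) +_) no-y) (+-identityʳ _)))

  occurs-a : ∀ k → Occurs t a k (σ k)
  occurs-a k = block-a k ,
    trans (cong (count a) (fixed k)) (trans (count-τ-a (prefix t k)) (length-applyUpTo t k))

  occurs-b : ∀ k → Occurs t b k (σ (σ k) + 1)
  occurs-b k with eq , cnt ← occurs-a k = block-second (σ k) eq refl ,
    trans (count-σ+1 b (σ k) refl) (trans (count-τ-b (prefix t (σ k))) cnt)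

  occurs-c : ∀ k → Occurs t c k (σ (σ (σ k) + 1) + 1)
  occurs-c k with eq , cnt ← occurs-b k = block-second (σ (σ k) + 1) eq refl ,
    trans (count-σ+1 c (σ (σ k) + 1) refl) (trans (count-τ-c (prefix t (σ (σ k) + 1))) cnt)

  -- Values of admissible strings as positions

  -- The position reached from position m by reading a string from its most
  -- significant digit: the digit e selects the letter number e, counted from
  -- 0, of the block of the current position.
  positionFrom : ℕ → List Bit → ℕ
  positionFrom m []      = m
  positionFrom m (e ∷ E) = positionFrom (σ m + toℕ e) E

  positionFrom-++ : ∀ m E F → positionFrom m (E ++ F) ≡ positionFrom (positionFrom m E) F
  positionFrom-++ m []      F = refl
  positionFrom-++ m (e ∷ E) F = positionFrom-++ (σ m + toℕ e) E F

  -- The length of the image under τᵏ of the first m letters of t.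
  σ^ : ℕ → ℕ → ℕ
  σ^ k m = τ-length* k (prefix t m)

  σ^-zero : ∀ m → σ^ 0 m ≡ m
  σ^-zero m = trans (τ-length*-zero (prefix t m)) (length-applyUpTo t m)

  σ^-σ : ∀ k m → σ^ k (σ m) ≡ σ^ (suc k) m
  σ^-σ k m = trans (cong (τ-length* k) (fixed m)) (sym (τ-length*-suc k (prefix t m)))

  σ^-digit : ∀ k m (e : Bit) → σ^ k (σ m + toℕ e) ≡ σ^ (suc k) m + toℕ e * T k
  σ^-digit k m zero       = trans (cong (σ^ k) (+-identityʳ (σ m))) (trans (σ^-σ k m) (sym (+-identityʳ _)))
  σ^-digit k m (suc zero) = trans (cong (τ-length* k) (prefix-σ+1 m))
    (trans (τ-length*-++ k (τ-prefix m) [ a ])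
      (cong₂ _+_ (sym (τ-length*-suc k (prefix t m))) (cong (_+ 0) (τ-length-a k))))

  -- By induction on E: the digit in front of it moves m to σ m + e, and σ^-digit
  -- shows that this contributes exactly the weighted digit  e · T |E|.
  positionFrom-value : ∀ {x} m E → t m ≡ x → Admissible x E →
    positionFrom m E ≡ σ^ (length E) m + [ E ]T
  positionFrom-value m []      eq end = sym (trans (+-identityʳ _) (σ^-zero m))
  positionFrom-value m (e ∷ E) eq p   = begin
    positionFrom (σ m + toℕ e) E                            ≡⟨ rest p eq ⟩
    σ^ (length E) (σ m + toℕ e) + [ E ]T                    ≡⟨ cong (_+ [ E ]T) (σ^-digit (length E) m e) ⟩
    σ^ (suc (length E)) m + toℕ e * T (length E) + [ E ]T   ≡⟨ +-assoc (σ^ (suc (length E)) m) _ _ ⟩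
    σ^ (suc (length E)) m + [ e ∷ E ]T                      ∎
    where
    open ≡-Reasoning
    -- The next position carries the letter from which E is admissible.
    rest : ∀ {x e} → Admissible x (e ∷ E) → t m ≡ x →
      positionFrom (σ m + toℕ e) E ≡ σ^ (length E) (σ m + toℕ e) + [ E ]T
    rest (zero p)  eq = positionFrom-value _ E (trans (cong t (+-identityʳ (σ m))) (block-a m)) p
    rest (one-a p) eq = positionFrom-value _ E (block-second m eq refl) p
    rest (one-b p) eq = positionFrom-value _ E (block-second m eq refl) p

  module _ (t0≡a : t 0 ≡ a) where

    value≡position : ∀ {E} → Admissible a E → [ E ]T ≡ positionFrom 0 E
    value≡position {E} p = sym (positionFrom-value 0 E t0≡a p)

    ⟨⟩-++-value : ∀ k F → Admissible a F → [ ⟨ k ⟩T ++ 0b ∷ F ]T ≡ positionFrom (σ k) F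
    ⟨⟩-++-value k F p = begin
      [ ⟨ k ⟩T ++ 0b ∷ F ]T                       ≡⟨ value≡position (admissible-++0 (⟨⟩-admissible k) p) ⟩
      positionFrom 0 (⟨ k ⟩T ++ 0b ∷ F)           ≡⟨ positionFrom-++ 0 ⟨ k ⟩T (0b ∷ F) ⟩
      positionFrom (positionFrom 0 ⟨ k ⟩T) (0b ∷ F)
        ≡⟨ cong (λ m → positionFrom m (0b ∷ F)) (trans (sym (value≡position (⟨⟩-admissible k))) (⟨⟩-value k)) ⟩
      positionFrom k (0b ∷ F)                     ≡⟨ cong (λ m → positionFrom m F) (+-identityʳ (σ k)) ⟩
      positionFrom (σ k) F                        ∎
      where open ≡-Reasoning

theorem14 : (t : Word∞) → IsTribonacciWord t → (n : ℕ) → 1 ≤ n →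
    (∀ i → IsNthOccurrence t a n i ⇔ i ≡ [ ⟨ n ∸ 1 ⟩T ++ 0b ∷ [] ]T + 1) ×
    (∀ i → IsNthOccurrence t b n i ⇔ i ≡ [ ⟨ n ∸ 1 ⟩T ++ 0b ∷ 1b ∷ [] ]T + 1) ×
    (∀ i → IsNthOccurrence t c n i ⇔ i ≡ [ ⟨ n ∸ 1 ⟩T ++ 0b ∷ 1b ∷ 1b ∷ [] ]T + 1)
theorem14 t (t0≡a , fixed) (suc k) (s≤s z≤n) =
  nth a (occurs-a t fixed k) end ,
  nth b (occurs-b t fixed k) (one-a end) ,
  nth c (occurs-c t fixed k) (one-a (one-b end))
  where
  nth : ∀ x {F} → Occurs t x k (positionFrom t fixed (σ t fixed k) F) → Admissible a F →
    ∀ i → IsNthOccurrence t x (suc k) i ⇔ i ≡ [ ⟨ k ⟩T ++ 0b ∷ F ]T + 1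
  nth x {F} occ p = occurs⇒isNthOccurrence⇔ t x
    (subst (Occurs t x k) (sym (⟨⟩-++-value t fixed t0≡a k F p)) occ)
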